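{- The number of labeled split graphs on $n$ vertices is $$\sum_{k=0}^n\binom{n}{k}2^{k(n-k)}-n\sum_{k=0}^{n-1}\binom{n-1}{k}2^{k(n-k-1)}.$$
   Context: Graphs are finite and simple. A split graph is a graph whose vertices can be partitioned into two (possibly empty) sets $K$ and $S$ such that $K$ is a clique and $S$ is a stable (independent) set. Labeled graphs on $n$ vertices are graphs with vertex set $\{1,\dots,n\}$. -}

module Defs where

open import Data.Bool.Base using (Bool; true; false)
open import Data.Fin.Base using (Fin)
open import Data.Fin.Subset using (Subset; ⊤; Empty; _∈_; _∪_; _∩_)
open import Data.Nat.Base using (ℕ)
open import Data.Product.Base using (Σ; ∃₂; _×_; proj₁)
open import Function.Bundles using (Inverse)
open import Level using (Level; 0ℓ)
open import Relation.Binary.Bundles using (Setoid)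
open import Relation.Binary.PropositionalEquality using (_≡_; _≢_; refl; sym; trans; setoid)
import Relation.Binary.Construct.On as On
open import Relation.Nullary.Negation.Core using (¬_)

-- The vertex set {1, …, n} is represented by Fin n.
record Graph (n : ℕ) : Set where
  field
    adjacent    : Fin n → Fin n → Bool
    symmetric   : ∀ u v → adjacent u v ≡ adjacent v u
    irreflexive : ∀ v → adjacent v v ≡ false

  Adj : Fin n → Fin n → Set
  Adj u v = adjacent u v ≡ true

open Graph public

module _ {n : ℕ} (G : Graph n) where

  IsClique : Subset n → Set
  IsClique K = ∀ {u v} → u ∈ K → v ∈ K → u ≢ v → Adj G u v

  IsStable : Subset n → Set
  IsStable S = ∀ {u v} → u ∈ S → v ∈ S → ¬ Adj G u v

  IsSplit : Set
  IsSplit = ∃₂ λ (K S : Subset n) →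
    (K ∪ S ≡ ⊤) × Empty (K ∩ S) × IsClique K × IsStable S

-- Labeled graphs are equal when they have the same edges; graph isomorphism
-- plays no role.
graphSetoid : ℕ → Setoid 0ℓ 0ℓ
graphSetoid n = record
  { Carrier       = Graph n
  ; _≈_           = λ G H → ∀ u v → adjacent G u v ≡ adjacent H u v
  ; isEquivalence = record
    { refl  = λ _ _ → refl
    ; sym   = λ p u v → sym (p u v)
    ; trans = λ p q u v → trans (p u v) (q u v)
    }
  }

-- Equality ignores the chosen partition, so a graph with several split
-- partitions is counted once.
splitGraphSetoid : ℕ → Setoid 0ℓ 0ℓ
splitGraphSetoid n = On.setoid {B = Σ (Graph n) IsSplit} (graphSetoid n) proj₁

HasCardinality : ∀ {a ℓ : Level} → Setoid a ℓ → ℕ → Set _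
HasCardinality A c = Inverse A (setoid (Fin c))

{-# OPTIONS --safe #-}

-- Count pairs of a graph and a split partition (K , V ∖ K) of it: there are Σₖ (n C k) 2^(k(n-k)).
-- A swing (L , v) is a partition L together with a vertex v ∉ L adjacent to all of L and to
-- nothing else, so that L ∪ {v} is a partition as well; deleting v shows that there are
-- n Σₖ (n-1 C k) 2^(k(n-1-k)) swings. For a fixed split graph the swings are the edges
-- of a tree on its partitions, which therefore has one more partition than swings. Concretely,
-- every partition but one is matched with the swing leading towards a root.

module Submission where

open import Defs
open import Data.Fin.Base using (toℕ)
open import Data.Integer.Base using (+_; _-_)
open import Data.Nat.Base using (ℕ; _*_; _∸_; _^_)
open import Data.Nat.Combinatorics using (_C_)
open import Data.Nat.Properties using (+-0-commutativeMonoid)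
open import Data.Product.Base using (∃-syntax; _×_)
open import Relation.Binary.PropositionalEquality using (_≡_)
open import Algebra.Properties.CommutativeMonoid.Sum +-0-commutativeMonoid using (sum-syntax; sum⁺-syntax)
open import Algebra.Properties.CommutativeMonoid.Sum +-0-commutativeMonoid
  using (sum-cong-≗; sum-init-last; ∑-distrib-+)
open import Data.Bool.Base using (Bool; true; false; not)
import Data.Bool.Properties as Bool
open import Data.Bool.Properties using (¬-not)
open import Data.Empty using (⊥-elim)
open import Data.Fin.Base
  using (Fin; zero; suc; punchIn; punchOut; inject₁; fromℕ)
  renaming (_≤_ to _≤ᶠ_)
open import Data.Fin.Permutation using (↔⇒≡)
open import Data.Fin.Properties
  using (*↔×; +↔⊎; 2↔Bool; _≟_; any?; all?; punchIn-punchOut; punchIn-injective; toℕ-inject₁; toℕ-fromℕ)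
  renaming (_≤?_ to _≤ᶠ?_; ≤-antisym to ≤ᶠ-antisym)
open import Data.Fin.Subset
  using (Subset; inside; outside; _∈_; _∉_; _⊆_; _∪_; ⁅_⁆; ∁; ∣_∣)
  renaming (_-_ to _∖_)
open import Data.Fin.Subset.Properties
open import Data.Integer.Properties using (⊖-≥; m-n≡m⊖n)
open import Data.Maybe.Base using (Maybe; just; nothing)
open import Data.Nat.Base using (zero; suc; _+_; z≤n; s≤s)
open import Data.Nat.Combinatorics using (nCk+nC[k+1]≡[n+1]C[k+1]; k>n⇒nCk≡0)
open import Data.Nat.Properties
  using (^-*-assoc; *-comm; *-distribʳ-+; +-assoc; +-comm; +-identityʳ; n<1+n; m≤n+m;
         m+n∸n≡m; m+[n∸m]≡n; ∸-+-assoc; *-identityˡ)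
open import Data.Product.Base using (Σ; Σ-syntax; ∃; ∃₂; _,_; proj₁; proj₂)
open import Data.Product.Function.NonDependent.Setoid using (_×-inverse_)
open import Data.Product.Relation.Binary.Pointwise.NonDependent using (_×ₛ_; Pointwise-≡↔≡)
open import Data.Sum.Base as Sum using (_⊎_; inj₁; inj₂; [_,_]′)
open import Data.Sum.Function.Propositional using (_⊎-↔_)
open import Data.Vec.Base using (Vec; []; _∷_; lookup; insertAt; removeAt; tabulate; here; there)
open import Data.Vec.Properties
  using (lookup⇒[]=; []=⇒lookup; insertAt-lookup; insertAt-punchIn; insertAt-removeAt; removeAt-insertAt; lookup∘tabulate)
open import Function.Base using (_∘_; id)
open import Function.Bundles using (Inverse; _↔_; mk↔ₛ′)
open import Function.Properties.Inverse
  using (↔-sym; ↔-trans)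
  renaming (refl to inv-refl; sym to inv-sym; trans to inv-trans)
open import Level using (0ℓ)
import Relation.Binary.Construct.On as On
open import Relation.Binary.Bundles using (Setoid)
open import Relation.Binary.PropositionalEquality
  using (_≢_; refl; sym; trans; cong; cong₂; subst; setoid; module ≡-Reasoning)
open import Relation.Nullary.Decidable.Core using (Dec; yes; no; does; ⌊_⌋; _×-dec_; _→-dec_; ¬?)
open import Relation.Nullary.Negation.Core using (¬_; contradiction)
open import Relation.Unary using (Pred; Decidable)

private variable
  n : ℕ

-- Finite cardinalities of setoids

module _ {A B : Setoid 0ℓ 0ℓ} where
  private
    module A = Setoid A
    module B = Setoid B

  -- Totality on both sides supplies the two maps, and both inverse laws are instances of
  -- functionality and injectivity. Each bijection below is therefore given by one relation, with no
  -- separate congruence proofs.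
  inverseFromRelation : (R : A.Carrier → B.Carrier → Set) →
    (∀ a → ∃ λ b → R a b) → (∀ b → ∃ λ a → R a b) →
    (∀ {a a′ b b′} → R a b → R a′ b′ → a A.≈ a′ → b B.≈ b′) →
    (∀ {a a′ b b′} → R a b → R a′ b′ → b B.≈ b′ → a A.≈ a′) →
    Inverse A B
  inverseFromRelation R left right functional injective = record
    { to        = λ a → proj₁ (left a)
    ; from      = λ b → proj₁ (right b)
    ; to-cong   = λ {a} {a′} → functional (proj₂ (left a)) (proj₂ (left a′))
    ; from-cong = λ {b} {b′} → injective (proj₂ (right b)) (proj₂ (right b′))
    ; inverse   = (λ {b} {a} → functional (proj₂ (left a)) (proj₂ (right b)))
                , (λ {a} {b} → injective (proj₂ (right b)) (proj₂ (left a)))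
    }

  ×-cardinality : ∀ {a b} → HasCardinality A a → HasCardinality B b → HasCardinality (A ×ₛ B) (a * b)
  ×-cardinality f g = inv-trans (f ×-inverse g) (inv-trans Pointwise-≡↔≡ (↔-sym *↔×))

cardinality-unique : ∀ {A : Setoid 0ℓ 0ℓ} {a b} → HasCardinality A a → HasCardinality A b → a ≡ b
cardinality-unique f g = ↔⇒≡ (inv-trans (inv-sym f) g)

-- Equality looks at first components only, so an element with several proofs of `P` counts once.
restrict : (A : Setoid 0ℓ 0ℓ) → Pred (Setoid.Carrier A) 0ℓ → Setoid 0ℓ 0ℓ
restrict A P = On.setoid {B = Σ (Setoid.Carrier A) P} A proj₁

subset-cardinality : (K : Subset n) → HasCardinality (restrict (setoid (Fin n)) (_∈ K)) ∣ K ∣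
subset-cardinality K = record
  { to        = λ (_ , i∈K) → rank i∈K
  ; from      = unrank K
  ; to-cong   = λ {(_ , p)} {(_ , q)} → rank-cong p q
  ; from-cong = cong (proj₁ ∘ unrank K)
  ; inverse   = (λ {i} {(_ , p)} p≡i → trans (rank-cong p (proj₂ (unrank K i)) p≡i) (rank-unrank K i))
              , (λ {(_ , p)} i≡p → trans (cong (proj₁ ∘ unrank K) i≡p) (unrank-rank p))
  }
  where
  rank : ∀ {n} {K : Subset n} {i} → i ∈ K → Fin ∣ K ∣
  rank                   here        = zero
  rank {K = inside  ∷ _} (there i∈K) = suc (rank i∈K)
  rank {K = outside ∷ _} (there i∈K) = rank i∈K

  unrank : ∀ {n} (K : Subset n) → Fin ∣ K ∣ → ∃ (_∈ K)
  unrank (inside  ∷ K) zero    = zero , here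
  unrank (inside  ∷ K) (suc i) = let j , j∈K = unrank K i in suc j , there j∈K
  unrank (outside ∷ K) i       = let j , j∈K = unrank K i in suc j , there j∈K

  rank-cong : ∀ {n} {K : Subset n} {i j} (p : i ∈ K) (q : j ∈ K) → i ≡ j → rank p ≡ rank q
  rank-cong                   here      here      refl = refl
  rank-cong {K = inside  ∷ _} (there p) (there q) refl = cong suc (rank-cong p q refl)
  rank-cong {K = outside ∷ _} (there p) (there q) refl = rank-cong p q refl

  rank-unrank : ∀ {n} (K : Subset n) i → rank (proj₂ (unrank K i)) ≡ i
  rank-unrank (inside  ∷ K) zero    = refl
  rank-unrank (inside  ∷ K) (suc i) = cong suc (rank-unrank K i)
  rank-unrank (outside ∷ K) i       = rank-unrank K i

  unrank-rank : ∀ {n} {K : Subset n} {i} (p : i ∈ K) → proj₁ (unrank K (rank p)) ≡ i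
  unrank-rank                   here      = refl
  unrank-rank {K = inside  ∷ _} (there p) = cong suc (unrank-rank p)
  unrank-rank {K = outside ∷ _} (there p) = cong suc (unrank-rank p)

module _ {A : Setoid 0ℓ 0ℓ} where
  open Setoid A renaming (refl to ≈-refl; sym to ≈-sym; trans to ≈-trans)

  restrict-cardinality : ∀ {a} {P : Pred Carrier 0ℓ} (A≅a : HasCardinality A a) (K : Subset a) →
    (∀ {x} → P x → Inverse.to A≅a x ∈ K) → (∀ {i} → i ∈ K → P (Inverse.from A≅a i)) →
    HasCardinality (restrict A P) ∣ K ∣
  restrict-cardinality A≅a K P⇒∈ ∈⇒P = inv-trans
    (inverseFromRelation (λ (x , _) (i , _) → to x ≡ i)
      (λ (x , px) → (to x , P⇒∈ px) , refl)
      (λ (i , i∈K) → (from i , ∈⇒P i∈K) , strictlyInverseˡ i)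
      (λ { refl refl → to-cong })
      (λ { {a′ = x′ , _} refl refl x≡x′ → ≈-trans (≈-sym (inverseʳ (sym x≡x′))) (strictlyInverseʳ x′) }))
    (subset-cardinality K)
    where open Inverse A≅a

  -- The truth values of `P` along the enumeration form a subset of `Fin a`; it and its complement
  -- count the two restrictions.
  cardinality-split : ∀ {a} {P : Pred Carrier 0ℓ} → Decidable P → (∀ {x y} → x ≈ y → P x → P y) →
    HasCardinality A a →
    ∃₂ λ c d → HasCardinality (restrict A (¬_ ∘ P)) c × HasCardinality (restrict A P) d × c + d ≡ a
  cardinality-split {a} {P} P? resp A≅a = ∣ ∁ K ∣ , ∣ K ∣ ,
    restrict-cardinality A≅a (∁ K)
      (λ ¬px → x∉p⇒x∈∁p (¬px ∘ resp (strictlyInverseʳ _) ∘ sound))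
      (λ i∈∁K → x∈∁p⇒x∉p i∈∁K ∘ complete) ,
    restrict-cardinality A≅a K (λ px → complete (resp (≈-sym (strictlyInverseʳ _)) px)) sound ,
    trans (+-comm ∣ ∁ K ∣ ∣ K ∣) (trans (cong (_+_ ∣ K ∣) (∣∁p∣≡n∸∣p∣ K)) (m+[n∸m]≡n (∣p∣≤n K)))
    where
    open Inverse A≅a
    K = tabulate (λ i → does (P? (from i)))

    complete : ∀ {i} → P (from i) → i ∈ K
    complete {i} p = lookup⇒[]= i K (trans (lookup∘tabulate _ i) (helper (P? (from i))))
      where
      helper : (d : Dec (P (from i))) → does d ≡ true
      helper (yes _) = refl
      helper (no ¬p) = contradiction p ¬p

    sound : ∀ {i} → i ∈ K → P (from i)
    sound {i} i∈K = helper (P? (from i)) (trans (sym (lookup∘tabulate _ i)) ([]=⇒lookup i∈K))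
      where
      helper : (d : Dec (P (from i))) → does d ≡ true → P (from i)
      helper (yes p) _ = p

-- Total functions compared only on `K` stand for functions with domain `K`, which avoids dependent
-- domains and function extensionality.
functionsOn : Subset n → Setoid 0ℓ 0ℓ → Setoid 0ℓ 0ℓ
functionsOn {n} K X = record
  { Carrier       = Fin n → Carrier
  ; _≈_           = λ f g → ∀ {i} → i ∈ K → f i ≈ g i
  ; isEquivalence = record
    { refl  = λ _ → ≈-refl
    ; sym   = λ f≈g i∈K → ≈-sym (f≈g i∈K)
    ; trans = λ f≈g g≈h i∈K → ≈-trans (f≈g i∈K) (g≈h i∈K)
    }
  }
  where open Setoid X renaming (refl to ≈-refl; sym to ≈-sym; trans to ≈-trans)

functionsOn-cardinality : ∀ {X : Setoid 0ℓ 0ℓ} {x} (K : Subset n) → Setoid.Carrier X → HasCardinality X x →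
  HasCardinality (functionsOn K X) (x ^ ∣ K ∣)
functionsOn-cardinality [] _ X≅x = record
  { to        = λ _ → zero
  ; from      = λ _ ()
  ; to-cong   = λ _ → refl
  ; from-cong = λ { _ () }
  ; inverse   = (λ { {zero} _ → refl }) , (λ { _ () })
  }
functionsOn-cardinality {X = X} (inside ∷ K) x₀ X≅x = inv-trans
  (inverseFromRelation {B = X ×ₛ functionsOn K X}
    (λ f (y , g) → f zero ≈ y × (∀ {i} → i ∈ K → f (suc i) ≈ g i))
    (λ f → (f zero , f ∘ suc) , ≈-refl , λ _ → ≈-refl)
    (λ (y , g) → (λ { zero → y ; (suc i) → g i }) , ≈-refl , λ _ → ≈-refl)
    (λ (p , ps) (q , qs) r →
      ≈-trans (≈-sym p) (≈-trans (r here) q) ,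
      λ i∈K → ≈-trans (≈-sym (ps i∈K)) (≈-trans (r (there i∈K)) (qs i∈K)))
    (λ { (p , ps) (q , qs) (r , rs) here        → ≈-trans p (≈-trans r (≈-sym q))
       ; (p , ps) (q , qs) (r , rs) (there i∈K) → ≈-trans (ps i∈K) (≈-trans (rs i∈K) (≈-sym (qs i∈K))) }))
  (×-cardinality X≅x (functionsOn-cardinality K x₀ X≅x))
  where open Setoid X renaming (refl to ≈-refl; sym to ≈-sym; trans to ≈-trans)
-- The value at an index outside the subset is invisible to the equality; `x₀` fills it.
functionsOn-cardinality {X = X} (outside ∷ K) x₀ X≅x = inv-trans
  (inverseFromRelation {B = functionsOn K X}
    (λ f g → ∀ {i} → i ∈ K → f (suc i) ≈ g i)
    (λ f → f ∘ suc , λ _ → ≈-refl)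
    (λ g → (λ { zero → x₀ ; (suc i) → g i }) , λ _ → ≈-refl)
    (λ ps qs r i∈K → ≈-trans (≈-sym (ps i∈K)) (≈-trans (r (there i∈K)) (qs i∈K)))
    (λ { ps qs rs (there i∈K) → ≈-trans (ps i∈K) (≈-trans (rs i∈K) (≈-sym (qs i∈K))) }))
  (functionsOn-cardinality K x₀ X≅x)
  where
  open Setoid X renaming (refl to ≈-refl; sym to ≈-sym; trans to ≈-trans)

-- Summing over subsets by size

∑-pascal : ∀ n (w : ℕ → ℕ) →
  ∑[ k ≤ n ] ((n C toℕ k) * w (suc (toℕ k))) + ∑[ k ≤ n ] ((n C toℕ k) * w (toℕ k)) ≡
  ∑[ k ≤ suc n ] ((suc n C toℕ k) * w (toℕ k))
∑-pascal n w = sym (begin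
  (suc n C 0) * w 0 + ∑[ k ≤ n ] ((suc n C suc (toℕ k)) * w (suc (toℕ k)))
    ≡⟨ cong (_+_ w₀) (sum-cong-≗ {suc n} λ k →
         trans (cong (_* w (suc (toℕ k))) (sym (nCk+nC[k+1]≡[n+1]C[k+1] n (toℕ k))))
               (*-distribʳ-+ (w (suc (toℕ k))) (n C toℕ k) (n C suc (toℕ k)))) ⟩
  w₀ + ∑[ k ≤ n ] (f k + g k)
    ≡⟨ cong (_+_ w₀) (∑-distrib-+ f g) ⟩
  w₀ + (∑[ k ≤ n ] f k + ∑[ k ≤ n ] g k)
    ≡⟨ cong (_+_ w₀) (+-comm (∑[ k ≤ n ] f k) _) ⟩
  w₀ + (∑[ k ≤ n ] g k + ∑[ k ≤ n ] f k)
    ≡⟨ +-assoc w₀ _ _ ⟨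
  -- By definition `h` is `w₀` followed by `g`. Splitting off its last term instead brings the
  -- indices back to `k ≤ n`, and that last term is zero because `n C suc n` is.
  ∑[ k ≤ suc n ] h k + ∑[ k ≤ n ] f k
    ≡⟨ +-comm (∑[ k ≤ suc n ] h k) _ ⟩
  ∑[ k ≤ n ] f k + ∑[ k ≤ suc n ] h k
    ≡⟨ cong (_+_ (∑[ k ≤ n ] f k)) (sum-init-last h) ⟩
  ∑[ k ≤ n ] f k + (∑[ k ≤ n ] h (inject₁ k) + h (fromℕ (suc n)))
    ≡⟨ cong (_+_ (∑[ k ≤ n ] f k)) (cong₂ _+_
         (sum-cong-≗ {suc n} λ k → cong (λ j → (n C j) * w j) (toℕ-inject₁ k))
         (trans (cong (λ j → (n C j) * w j) (toℕ-fromℕ (suc n)))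
                (cong (_* w (suc n)) (k>n⇒nCk≡0 (n<1+n n))))) ⟩
  ∑[ k ≤ n ] f k + (∑[ k ≤ n ] ((n C toℕ k) * w (toℕ k)) + 0)
    ≡⟨ cong (_+_ (∑[ k ≤ n ] f k)) (+-identityʳ _) ⟩
  ∑[ k ≤ n ] f k + ∑[ k ≤ n ] ((n C toℕ k) * w (toℕ k)) ∎)
  where
  open ≡-Reasoning
  w₀ = (n C 0) * w 0
  f g : Fin (suc n) → ℕ
  f k = (n C toℕ k) * w (suc (toℕ k))
  g k = (n C suc (toℕ k)) * w (suc (toℕ k))
  h : Fin (suc (suc n)) → ℕ
  h k = (n C toℕ k) * w (toℕ k)

-- Induction on whether the first element is inside: that half has its weight shifted to `w ∘ suc`,
-- and Pascal's rule merges the two sums.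
Σ-subset-cardinality : ∀ n (w : ℕ → ℕ) →
  (Σ[ K ∈ Subset n ] Fin (w ∣ K ∣)) ↔ Fin (∑[ k ≤ n ] ((n C toℕ k) * w (toℕ k)))
Σ-subset-cardinality zero w = subst (λ c → (Σ[ K ∈ Subset zero ] Fin (w ∣ K ∣)) ↔ Fin c) (sym (trans (+-identityʳ _) (*-identityˡ (w 0))))
  (mk↔ₛ′ (λ { ([] , i) → i }) ([] ,_) (λ _ → refl) (λ { ([] , _) → refl }))
Σ-subset-cardinality (suc n) w = subst (λ c → (Σ[ K ∈ Subset (suc n) ] Fin (w ∣ K ∣)) ↔ Fin c) (∑-pascal n w)
  (↔-trans
    (mk↔ₛ′ (λ { (inside ∷ K , i) → inj₁ (K , i) ; (outside ∷ K , i) → inj₂ (K , i) })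
           (λ { (inj₁ (K , i)) → inside ∷ K , i ; (inj₂ (K , i)) → outside ∷ K , i })
           (λ { (inj₁ _) → refl ; (inj₂ _) → refl })
           (λ { (inside ∷ _ , _) → refl ; (outside ∷ _ , _) → refl }))
    (↔-trans (Σ-subset-cardinality n (w ∘ suc) ⊎-↔ Σ-subset-cardinality n w) (↔-sym +↔⊎)))

-- Split partitions

-- The stable side is the complement of `K`, so a partition is recorded by a single subset.
record IsSplitting (G : Graph n) (K : Subset n) : Set where
  field
    clique : IsClique G K
    stable : ∀ {u v} → u ∉ K → v ∉ K → ¬ Adj G u v

open IsSplitting

_≈ᴳ_ : Graph n → Graph n → Set
_≈ᴳ_ {n} = Setoid._≈_ (graphSetoid n)

≈ᴳ-sym : {G H : Graph n} → G ≈ᴳ H → H ≈ᴳ G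
≈ᴳ-sym {G = G} {H} = Setoid.sym (graphSetoid _) {G} {H}

≈ᴳ-trans : {G H I : Graph n} → G ≈ᴳ H → H ≈ᴳ I → G ≈ᴳ I
≈ᴳ-trans {G = G} {H} {I} = Setoid.trans (graphSetoid _) {G} {H} {I}

splitting-resp : ∀ {G H : Graph n} {K} → G ≈ᴳ H → IsSplitting G K → IsSplitting H K
splitting-resp G≈H s = record
  { clique = λ p q u≢v → trans (sym (G≈H _ _)) (clique s p q u≢v)
  ; stable = λ p q uv → stable s p q (trans (G≈H _ _) uv)
  }

adj-sym : (G : Graph n) → ∀ {u v} → Adj G u v → Adj G v u
adj-sym G {u} {v} uv = trans (symmetric G v u) uv

adj-irrefl : (G : Graph n) → ∀ {v} → ¬ Adj G v v
adj-irrefl G {v} vv with () ← trans (sym vv) (irreflexive G v)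

partitionedSetoid : ℕ → Setoid 0ℓ 0ℓ
partitionedSetoid n =
  restrict (graphSetoid n ×ₛ setoid (Subset n)) λ (G , K) → IsSplitting G K

partitionedCount : ℕ → ℕ
partitionedCount n = ∑[ k ≤ n ] ((n C toℕ k) * 2 ^ (toℕ k * (n ∸ toℕ k)))

-- A split partition amounts to its clique K and the edges from K to its complement.
crossSetoid : ℕ → Setoid 0ℓ 0ℓ
crossSetoid n = record
  { Carrier       = Subset n × (Fin n → Fin n → Bool)
  ; _≈_           = λ (K , F) (K′ , F′) → K ≡ K′ × (∀ {u} → u ∈ K → ∀ {v} → v ∈ ∁ K → F u v ≡ F′ u v)
  ; isEquivalence = record
    { refl  = refl , λ _ _ → refl
    ; sym   = λ { (refl , e) → refl , λ p q → sym (e p q) }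
    ; trans = λ { (refl , e) (refl , e′) → refl , λ p q → trans (e p q) (e′ p q) }
    }
  }

cross-cardinality : ∀ n → HasCardinality (crossSetoid n) (partitionedCount n)
cross-cardinality n = inv-trans fibrewise (Σ-subset-cardinality n (λ k → 2 ^ (k * (n ∸ k))))
  where
  exponent : (K : Subset n) → (2 ^ ∣ ∁ K ∣) ^ ∣ K ∣ ≡ 2 ^ (∣ K ∣ * (n ∸ ∣ K ∣))
  exponent K = trans (^-*-assoc 2 ∣ ∁ K ∣ ∣ K ∣)
    (cong (_^_ 2) (trans (*-comm ∣ ∁ K ∣ ∣ K ∣) (cong (_*_ ∣ K ∣) (∣∁p∣≡n∸∣p∣ K))))

  fibre : (K : Subset n) →
    HasCardinality (functionsOn K (functionsOn (∁ K) (setoid Bool))) (2 ^ (∣ K ∣ * (n ∸ ∣ K ∣)))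
  fibre K = subst (HasCardinality _) (exponent K)
    (functionsOn-cardinality K (λ _ → false)
      (functionsOn-cardinality (∁ K) false (↔-sym 2↔Bool)))

  fibrewise : Inverse (crossSetoid n) (setoid (Σ[ K ∈ Subset n ] Fin (2 ^ (∣ K ∣ * (n ∸ ∣ K ∣)))))
  fibrewise = record
    { to        = λ (K , F) → K , Inverse.to (fibre K) F
    ; from      = λ (K , i) → K , Inverse.from (fibre K) i
    ; to-cong   = λ { {K , _} (refl , F≈F′) → cong (K ,_) (Inverse.to-cong (fibre K) F≈F′) }
    ; from-cong = λ { refl → refl , λ _ _ → refl }
    ; inverse   = (λ { {K , _} (refl , F≈) → cong (K ,_) (Inverse.inverseˡ (fibre K) F≈) })
                , (λ { {K , _} refl → refl , Inverse.inverseʳ (fibre K) refl })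
    }

module _ (K : Subset n) (F : Fin n → Fin n → Bool) where
  private
    -- The Booleans are the memberships of `u` and `v` in `K`. `F` is only ever read with its clique
    -- endpoint first, which makes the result symmetric for any `F`.
    joined : Fin n → Fin n → Bool → Bool → Bool
    joined u v true  true  = not ⌊ u ≟ v ⌋
    joined u v true  false = F u v
    joined u v false true  = F v u
    joined u v false false = false

    joined-irrefl : ∀ v b → joined v v b b ≡ false
    joined-irrefl v false = refl
    joined-irrefl v true with v ≟ v
    ... | yes _  = refl
    ... | no v≢v = contradiction refl v≢v

    joined-sym : ∀ u v b c → joined u v b c ≡ joined v u c b
    joined-sym u v true  false = refl
    joined-sym u v false true  = refl
    joined-sym u v false false = refl
    joined-sym u v true  true with u ≟ v | v ≟ u
    ... | yes _   | yes _   = refl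
    ... | no _    | no _    = refl
    ... | yes u≡v | no v≢u  = contradiction (sym u≡v) v≢u
    ... | no u≢v  | yes v≡u = contradiction (sym v≡u) u≢v

  fromCross : Graph n
  fromCross = record
    { adjacent    = λ u v → joined u v (lookup K u) (lookup K v)
    ; symmetric   = λ u v → joined-sym u v (lookup K u) (lookup K v)
    ; irreflexive = λ v → joined-irrefl v (lookup K v)
    }

  private
    ∉⇒lookup : ∀ {u} → u ∉ K → lookup K u ≡ false
    ∉⇒lookup {u} u∉K = ¬-not (u∉K ∘ lookup⇒[]= u K)

  fromCross-splitting : IsSplitting fromCross K
  fromCross-splitting = record { clique = cl ; stable = st }
    where
    cl : IsClique fromCross K
    cl {u} {v} u∈K v∈K u≢v rewrite []=⇒lookup u∈K | []=⇒lookup v∈K with u ≟ v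
    ... | yes u≡v = contradiction u≡v u≢v
    ... | no _    = refl

    st : ∀ {u v} → u ∉ K → v ∉ K → ¬ Adj fromCross u v
    st u∉K v∉K uv rewrite ∉⇒lookup u∉K | ∉⇒lookup v∉K with () ← uv

  fromCross-cross : ∀ {u v} → u ∈ K → v ∉ K → adjacent fromCross u v ≡ F u v
  fromCross-cross u∈K v∉K rewrite []=⇒lookup u∈K | ∉⇒lookup v∉K = refl

-- Edges inside `K` and inside its complement are forced, so two graphs split by `K` can differ only
-- in the crossing edges.
splitting-determined : ∀ {G H : Graph n} {K} → IsSplitting G K → IsSplitting H K →
  (∀ {u} → u ∈ K → ∀ {v} → v ∈ ∁ K → adjacent G u v ≡ adjacent H u v) → G ≈ᴳ H
splitting-determined {G = G} {H} {K} s t cross u v with u ∈? K | v ∈? K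
... | no u∉K  | no v∉K  = trans (¬-not (stable s u∉K v∉K)) (sym (¬-not (stable t u∉K v∉K)))
... | yes u∈K | no v∉K  = cross u∈K (x∉p⇒x∈∁p v∉K)
... | no u∉K  | yes v∈K = trans (symmetric G u v)
  (trans (cross v∈K (x∉p⇒x∈∁p u∉K)) (symmetric H v u))
... | yes u∈K | yes v∈K with u ≟ v
...   | no u≢v   = trans (clique s u∈K v∈K u≢v) (sym (clique t u∈K v∈K u≢v))
...   | yes refl = trans (irreflexive G u) (sym (irreflexive H u))

partitioned-cardinality : ∀ n → HasCardinality (partitionedSetoid n) (partitionedCount n)
partitioned-cardinality n = inv-trans
  (inverseFromRelation {B = crossSetoid n}
    (λ ((G , K) , _) (K′ , F) → K ≡ K′ × (∀ {u} → u ∈ K → ∀ {v} → v ∈ ∁ K → adjacent G u v ≡ F u v))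
    (λ ((G , K) , _) → (K , adjacent G) , refl , λ _ _ → refl)
    (λ (K , F) → ((fromCross K F , K) , fromCross-splitting K F) , refl ,
      λ u∈K v∈∁K → fromCross-cross K F u∈K (x∈∁p⇒x∉p v∈∁K))
    (λ { (refl , e) (refl , e′) (G≈G′ , refl) → refl ,
      λ p q → trans (sym (e p q)) (trans (G≈G′ _ _) (e′ p q)) })
    (λ { {(_ , _) , s} {(_ , _) , s′} (refl , e) (refl , e′) (refl , F≈F′) →
      splitting-determined s s′ (λ p q → trans (e p q) (trans (F≈F′ p q) (sym (e′ p q)))) , refl }))
  (cross-cardinality n)

-- Swing vertices

Dominates : Graph n → Subset n → Fin n → Set
Dominates G K v = v ∉ K × (∀ u → u ∈ K → Adj G v u)

dominates? : (G : Graph n) (K : Subset n) → Decidable (Dominates G K)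
dominates? G K v = ¬? (v ∈? K) ×-dec all? (λ u → (u ∈? K) →-dec (adjacent G v u Bool.≟ true))

dominates-resp : ∀ {G H : Graph n} {K v} → G ≈ᴳ H → Dominates G K v → Dominates H K v
dominates-resp G≈H (v∉K , adj) = v∉K , λ u u∈K → trans (sym (G≈H _ _)) (adj u u∈K)

-- The swing vertex v may be placed on either side of the partition (K , V ∖ K).
IsSwing : Graph n → Subset n → Fin n → Set
IsSwing G K v = IsSplitting G K × Dominates G K v

swing-resp : ∀ {G H : Graph n} {K v} → G ≈ᴳ H → IsSwing G K v → IsSwing H K v
swing-resp {G = G} {H} G≈H (s , d) = splitting-resp G≈H s , dominates-resp {G = G} {H} G≈H d

swingSetoid : ℕ → Setoid 0ℓ 0ℓ
swingSetoid n = restrict ((graphSetoid n ×ₛ setoid (Subset n)) ×ₛ setoid (Fin n))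
  λ ((G , K) , v) → IsSwing G K v

-- Deleting and adding a swing vertex

module _ {m : ℕ} (v : Fin (suc m)) where

  -- A view for case analysis: a vertex is either `v` or the image of a vertex of the smaller graph.
  data Position : Fin (suc m) → Set where
    here  : Position v
    other : ∀ i → Position (punchIn v i)

  position : ∀ u → Position u
  position u with v ≟ u
  ... | yes refl = here
  ... | no v≢u   = subst Position (punchIn-punchOut v≢u) (other (punchOut v≢u))

  insertAt⁺ : ∀ {K : Subset m} {i} → i ∈ K → punchIn v i ∈ insertAt K v outside
  insertAt⁺ {K} {i} i∈K =
    lookup⇒[]= _ _ (trans (insertAt-punchIn K v outside i) ([]=⇒lookup i∈K))

  insertAt⁻ : ∀ {K : Subset m} {i} → punchIn v i ∈ insertAt K v outside → i ∈ K
  insertAt⁻ {K} {i} p =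
    lookup⇒[]= _ _ (trans (sym (insertAt-punchIn K v outside i)) ([]=⇒lookup p))

  ∉insertAt : ∀ {K : Subset m} → v ∉ insertAt K v outside
  ∉insertAt {K} p with () ← trans (sym ([]=⇒lookup p)) (insertAt-lookup K v outside)

  insertAt-removeAt-∉ : ∀ {L : Subset (suc m)} → v ∉ L → insertAt (removeAt L v) v outside ≡ L
  insertAt-removeAt-∉ {L} v∉L = subst (λ b → insertAt (removeAt L v) v b ≡ L)
    (¬-not (v∉L ∘ lookup⇒[]= v L)) (insertAt-removeAt L v)

  removeVertex : Graph (suc m) → Graph m
  removeVertex G = record
    { adjacent    = λ i j → adjacent G (punchIn v i) (punchIn v j)
    ; symmetric   = λ i j → symmetric G (punchIn v i) (punchIn v j)
    ; irreflexive = λ i → irreflexive G (punchIn v i)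
    }

  removeVertex-splitting : ∀ {G K} → IsSplitting G (insertAt K v outside) → IsSplitting (removeVertex G) K
  removeVertex-splitting s = record
    { clique = λ p q i≢j → clique s (insertAt⁺ p) (insertAt⁺ q) (i≢j ∘ punchIn-injective v _ _)
    ; stable = λ p q → stable s (p ∘ insertAt⁻) (q ∘ insertAt⁻)
    }

  module _ (H : Graph m) (K : Subset m) where
    private
      -- A partial inverse of `punchIn v`, stored as a vector so that adjacency in the larger graph
      -- is defined by lookup. `nothing` marks the new vertex, whose neighbourhood is made to be
      -- `K`.
      names : Vec (Maybe (Fin m)) (suc m)
      names = insertAt (tabulate just) v nothing

      name-here : lookup names v ≡ nothing
      name-here = insertAt-lookup (tabulate just) v nothing

      name-other : ∀ i → lookup names (punchIn v i) ≡ just i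
      name-other i = trans (insertAt-punchIn (tabulate just) v nothing i) (lookup∘tabulate just i)

      adjacentᵐ : Maybe (Fin m) → Maybe (Fin m) → Bool
      adjacentᵐ (just i) (just j) = adjacent H i j
      adjacentᵐ (just i) nothing  = lookup K i
      adjacentᵐ nothing  (just j) = lookup K j
      adjacentᵐ nothing  nothing  = false

      symmetricᵐ : ∀ x y → adjacentᵐ x y ≡ adjacentᵐ y x
      symmetricᵐ (just i) (just j) = symmetric H i j
      symmetricᵐ (just i) nothing  = refl
      symmetricᵐ nothing  (just j) = refl
      symmetricᵐ nothing  nothing  = refl

      irreflexiveᵐ : ∀ x → adjacentᵐ x x ≡ false
      irreflexiveᵐ (just i) = irreflexive H i
      irreflexiveᵐ nothing  = refl

    addVertex : Graph (suc m)
    addVertex = record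
      { adjacent    = λ u w → adjacentᵐ (lookup names u) (lookup names w)
      ; symmetric   = λ u w → symmetricᵐ (lookup names u) (lookup names w)
      ; irreflexive = λ u → irreflexiveᵐ (lookup names u)
      }

    addVertex-remove : removeVertex addVertex ≈ᴳ H
    addVertex-remove i j = cong₂ adjacentᵐ (name-other i) (name-other j)

    addVertex-new : ∀ i → adjacent addVertex v (punchIn v i) ≡ lookup K i
    addVertex-new i = cong₂ adjacentᵐ name-here (name-other i)

    addVertex-swing : IsSplitting H K → IsSwing addVertex (insertAt K v outside) v
    addVertex-swing s = record { clique = cl ; stable = st } , ∉insertAt , dom
      where
      cl : IsClique addVertex (insertAt K v outside)
      cl {u} {w} p q u≢w with position u | position w
      ... | here    | _       = contradiction p ∉insertAt
      ... | other _ | here    = contradiction q ∉insertAt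
      ... | other i | other j = trans (addVertex-remove i j)
        (clique s (insertAt⁻ p) (insertAt⁻ q) (u≢w ∘ cong (punchIn v)))

      new-stable : ∀ {i} → punchIn v i ∉ insertAt K v outside → ¬ Adj addVertex v (punchIn v i)
      new-stable {i} p e = p (insertAt⁺ (lookup⇒[]= i K (trans (sym (addVertex-new i)) e)))

      st : ∀ {u w} → u ∉ insertAt K v outside → w ∉ insertAt K v outside → ¬ Adj addVertex u w
      st {u} {w} p q e with position u | position w
      ... | here    | here    = adj-irrefl addVertex e
      ... | here    | other j = new-stable q e
      ... | other i | here    = new-stable p (adj-sym addVertex e)
      ... | other i | other j =
        stable s (p ∘ insertAt⁺) (q ∘ insertAt⁺) (trans (sym (addVertex-remove i j)) e)

      dom : ∀ u → u ∈ insertAt K v outside → Adj addVertex v u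
      dom u p with position u
      ... | here    = contradiction p ∉insertAt
      ... | other i = trans (addVertex-new i) ([]=⇒lookup (insertAt⁻ p))

  -- In a swing the neighbourhood of `v` is exactly `K`: domination gives the edges to `K`, and
  -- stability of the complement excludes all others.
  swing-determined : ∀ {G H K} → IsSwing G K v → IsSwing H K v → removeVertex G ≈ᴳ removeVertex H → G ≈ᴳ H
  swing-determined {G} {H} {K} (s , v∉K , d) (s′ , _ , d′) e u w = go (position u) (position w)
    where
    new : ∀ x → adjacent G v x ≡ adjacent H v x
    new x with x ∈? K
    ... | yes x∈K = trans (d x x∈K) (sym (d′ x x∈K))
    ... | no x∉K  = trans (¬-not (stable s v∉K x∉K)) (sym (¬-not (stable s′ v∉K x∉K)))

    go : ∀ {u w} → Position u → Position w → adjacent G u w ≡ adjacent H u w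
    go here      y         = new _
    go (other i) (other j) = e i j
    go (other i) here      = trans (symmetric G _ v) (trans (new _) (symmetric H v _))

-- Deleting `v` leaves a split partition of the other vertices, and `addVertex` reverses this. For
-- `n = 0` the factor `n` vanishes, so the truncation in `n ∸ 1` does no harm.
swing-cardinality : ∀ n → HasCardinality (swingSetoid n) (n * partitionedCount (n ∸ 1))
swing-cardinality zero = record
  { to        = λ ((_ , v) , _) → v
  ; from      = λ ()
  ; to-cong   = proj₂
  ; from-cong = λ { {()} }
  ; inverse   = (λ { {()} }) , λ { {(_ , ()) , _} }
  }
swing-cardinality (suc m) = inv-trans
  (inverseFromRelation {B = setoid (Fin (suc m)) ×ₛ partitionedSetoid m}
    (λ (((G , L) , v) , _) (w , ((H , K) , _)) → v ≡ w × removeVertex v G ≈ᴳ H × L ≡ insertAt K v outside)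
    (λ (((G , L) , v) , (s , v∉L , _)) →
      (v , (removeVertex v G , removeAt L v) ,
        removeVertex-splitting v (subst (IsSplitting G) (sym (insertAt-removeAt-∉ v v∉L)) s)) ,
      refl , (λ _ _ → refl) , sym (insertAt-removeAt-∉ v v∉L))
    (λ (v , (H , K) , s) →
      (((addVertex v H K , insertAt K v outside) , v) , addVertex-swing v H K s) ,
      refl , addVertex-remove v H K , refl)
    (λ { {((_ , _) , v) , _} {b = _ , (_ , K) , _} {b′ = _ , (_ , K′) , _}
         (refl , e , refl) (refl , e′ , p) ((G≈G′ , q) , refl) → refl ,
         (λ i j → trans (sym (e i j)) (trans (G≈G′ _ _) (e′ i j))) ,
         trans (sym (removeAt-insertAt K v outside))
           (trans (cong (λ L → removeAt L v) (trans q p)) (removeAt-insertAt K′ v outside)) })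
    (λ { {((_ , _) , v) , s} {((_ , _) , _) , s′} (refl , e , refl) (refl , e′ , refl) (refl , H≈H′ , refl) →
         (swing-determined v s s′ (λ i j → trans (e i j) (trans (H≈H′ i j) (sym (e′ i j)))) , refl) , refl }))
  (×-cardinality {A = setoid (Fin (suc m))} (inv-refl _) (partitioned-cardinality m))

-- The least swing vertex and canonical partitions

Least : Pred (Fin n) 0ℓ → Pred (Fin n) 0ℓ
Least P v = P v × (∀ w → P w → v ≤ᶠ w)

least? : {P : Pred (Fin n) 0ℓ} → Decidable P → Decidable (Least P)
least? P? v = P? v ×-dec all? (λ w → P? w →-dec (v ≤ᶠ? w))

least-unique : ∀ {P : Pred (Fin n) 0ℓ} {v w} → Least P v → Least P w → v ≡ w
least-unique (pv , v≤) (pw , w≤) = ≤ᶠ-antisym (v≤ _ pw) (w≤ _ pv)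

least-resp : ∀ {P Q : Pred (Fin n) 0ℓ} {v} → (∀ {w} → P w → Q w) → (∀ {w} → Q w → P w) →
  Least P v → Least Q v
least-resp f g (pv , v≤) = f pv , λ w → v≤ w ∘ g

least : {P : Pred (Fin n) 0ℓ} → Decidable P → ∃ P → ∃ (Least P)
least {zero} P? (() , _)
least {suc n} P? (i , pi) with P? zero
... | yes p0 = zero , p0 , λ _ _ → z≤n
... | no ¬p0 with i
...   | zero  = contradiction pi ¬p0
...   | suc j = let k , pk , k≤ = least (P? ∘ suc) (j , pi) in
  suc k , pk , λ { zero p → contradiction p ¬p0 ; (suc w) p → s≤s (k≤ w p) }

-- Inserting and removing one element of a subset

∈-insert⁺ : ∀ {L : Subset n} {v} → v ∈ L ∪ ⁅ v ⁆
∈-insert⁺ {v = v} = x∈p∪q⁺ (inj₂ (x∈⁅x⁆ v))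

∈-insert⁻ : ∀ {L : Subset n} {u v} → u ≢ v → u ∈ L ∪ ⁅ v ⁆ → u ∈ L
∈-insert⁻ {v = v} u≢v p = [ id , (λ q → contradiction (x∈⁅y⁆⇒x≡y v q) u≢v) ]′ (x∈p∪q⁻ _ _ p)

∉-∖ : ∀ {L : Subset n} {v} → v ∉ L ∖ v
∉-∖ {L = _ ∷ _}       {suc v} (there p) = ∉-∖ p
∉-∖ {L = inside ∷ _}  {zero} ()
∉-∖ {L = outside ∷ _} {zero} ()

∉-∖⁻ : ∀ {K : Subset n} {u v} → u ∉ K ∖ v → u ≢ v → u ∉ K
∉-∖⁻ u∉ u≢v u∈K = u∉ (x∈p∧x≢y⇒x∈p-y u∈K u≢v)

insert-∖ : ∀ {K : Subset n} {v} → v ∈ K → K ≡ (K ∖ v) ∪ ⁅ v ⁆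
insert-∖ {K = K} {v} v∈K = ⊆-antisym forth back
  where
  forth : K ⊆ (K ∖ v) ∪ ⁅ v ⁆
  forth {u} u∈K with u ≟ v
  ... | yes refl = ∈-insert⁺ {L = K ∖ v}
  ... | no u≢v   = x∈p∪q⁺ (inj₁ (x∈p∧x≢y⇒x∈p-y u∈K u≢v))
  back : (K ∖ v) ∪ ⁅ v ⁆ ⊆ K
  back {u} p with u ≟ v
  ... | yes refl = v∈K
  ... | no u≢v   = p─q⊆p K ⁅ v ⁆ (∈-insert⁻ u≢v p)

insert-injective : ∀ {L M : Subset n} {v} → v ∉ L → v ∉ M → L ∪ ⁅ v ⁆ ≡ M ∪ ⁅ v ⁆ → L ≡ M
insert-injective {v = v} v∉L v∉M e = ⊆-antisym (half v∉L e) (half v∉M (sym e))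
  where
  half : ∀ {L M} → v ∉ L → L ∪ ⁅ v ⁆ ≡ M ∪ ⁅ v ⁆ → L ⊆ M
  half v∉L e u∈L = ∈-insert⁻ (λ { refl → v∉L u∈L }) (subst (_ ∈_) e (x∈p∪q⁺ (inj₁ u∈L)))

-- A swing (L , v) of G joins the partitions with cliques L and L ∪ ⁅ v ⁆. It is
-- assigned to the former when v is the least swing vertex of L, and otherwise to the latter.
Assigned : Graph n → Subset n → Subset n → Fin n → Set
Assigned G K L v =
  (K ≡ L × Least (Dominates G L) v) ⊎ (K ≡ L ∪ ⁅ v ⁆ × ¬ Least (Dominates G L) v)

-- The partitions failing this are the canonical ones, the roots of the trees.
HasSwing : Graph n → Subset n → Set
HasSwing G K = ∃₂ λ L v → IsSwing G L v × Assigned G K L v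

assigned-resp : ∀ {G H : Graph n} {K L v} → G ≈ᴳ H → Assigned G K L v → Assigned H K L v
assigned-resp {G = G} {H} G≈H = Sum.map
  (λ (e , l) → e , least-resp G⇒H H⇒G l)
  (λ (e , ¬l) → e , ¬l ∘ least-resp H⇒G G⇒H)
  where
  G⇒H : ∀ {L w} → Dominates G L w → Dominates H L w
  G⇒H = dominates-resp {G = G} {H} G≈H
  H⇒G : ∀ {L w} → Dominates H L w → Dominates G L w
  H⇒G = dominates-resp {G = H} {G} (≈ᴳ-sym {G = G} {H} G≈H)

hasSwing-resp : ∀ {G H : Graph n} {K} → G ≈ᴳ H → HasSwing G K → HasSwing H K
hasSwing-resp {G = G} {H} G≈H (L , v , s , a) =
  L , v , swing-resp G≈H s , assigned-resp {G = G} {H} G≈H a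

-- Swings and partitions of a fixed graph

module _ (G : Graph n) where

  least-dominating : ∀ {K v} → Dominates G K v → ∃ (Least (Dominates G K))
  least-dominating {K} {v} d = least (dominates? G K) (v , d)

  dominates⇒hasSwing : ∀ {K v} → IsSplitting G K → Dominates G K v → HasSwing G K
  dominates⇒hasSwing s d = let w , l = least-dominating d in
    _ , w , (s , proj₁ l) , inj₁ (refl , l)

  insert-splitting : ∀ {L v} → IsSwing G L v → IsSplitting G (L ∪ ⁅ v ⁆)
  insert-splitting {L} {v} (s , v∉L , d) = record
    { clique = cl
    ; stable = λ p q → stable s (p ∘ x∈p∪q⁺ ∘ inj₁) (q ∘ x∈p∪q⁺ ∘ inj₁)
    }
    where
    cl : IsClique G (L ∪ ⁅ v ⁆)
    cl {u} {w} p q u≢w with u ≟ v | w ≟ v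
    ... | yes refl | yes refl = contradiction refl u≢w
    ... | yes refl | no w≢v   = d w (∈-insert⁻ w≢v q)
    ... | no u≢v   | yes refl = adj-sym G (d u (∈-insert⁻ u≢v p))
    ... | no u≢v   | no w≢v   = clique s (∈-insert⁻ u≢v p) (∈-insert⁻ w≢v q) u≢w

  -- A vertex dominating `L ∪ ⁅ v ⁆` would be adjacent to `v`, although both lie outside `L`. Hence
  -- no partition is the smaller end of one swing and the larger end of another.
  insert-undominated : ∀ {L v w} → IsSwing G L v → ¬ Dominates G (L ∪ ⁅ v ⁆) w
  insert-undominated {L} (s , v∉L , _) (w∉K , d) =
    stable s (w∉K ∘ x∈p∪q⁺ ∘ inj₁) v∉L (d _ (∈-insert⁺ {L = L}))

  -- If w ≠ v, some y ≠ w dominates M ∋ v, so y is adjacent to v although both lie outside L.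
  insert-unique : ∀ {L M v w} → IsSwing G L v → IsSwing G M w → ¬ Least (Dominates G M) w →
    L ∪ ⁅ v ⁆ ≡ M ∪ ⁅ w ⁆ → v ≡ w
  insert-unique {L} {M} {v} {w} (s , v∉L , _) (_ , dw) ¬least e with v ≟ w
  ... | yes v≡w = v≡w
  ... | no v≢w  = let y , l@((y∉M , d) , _) = least-dominating dw in
    ⊥-elim (stable s
      (λ y∈L → y∉M (∈-insert⁻ (λ y≡w → ¬least (subst (Least (Dominates G M)) y≡w l)) (subst (y ∈_) e (x∈p∪q⁺ (inj₁ y∈L)))))
      v∉L
      (d v (∈-insert⁻ v≢w (subst (v ∈_) e (∈-insert⁺ {L = L})))))

  -- The first kind of assignment needs a vertex dominating `K`, the second rules one out, so both
  -- swings are of the same kind. Then uniqueness of the least vertex or `insert-unique` applies.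
  assigned-functional : ∀ {K L M v w} → IsSwing G L v → IsSwing G M w →
    Assigned G K L v → Assigned G K M w → L ≡ M × v ≡ w
  assigned-functional s t (inj₁ (refl , l)) (inj₁ (refl , l′)) = refl , least-unique l l′
  assigned-functional s t (inj₁ (refl , l)) (inj₂ (refl , _)) = contradiction (proj₁ l) (insert-undominated t)
  assigned-functional s t (inj₂ (refl , _)) (inj₁ (refl , l)) = contradiction (proj₁ l) (insert-undominated s)
  assigned-functional s@(_ , v∉L , _) t@(_ , w∉M , _) (inj₂ (refl , _)) (inj₂ (e , ¬l))
    with refl ← insert-unique s t ¬l e = insert-injective v∉L w∉M e , refl

  assigned-injective : ∀ {K K′ L v} → Assigned G K L v → Assigned G K′ L v → K ≡ K′
  assigned-injective (inj₁ (refl , _)) (inj₁ (refl , _))  = refl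
  assigned-injective (inj₁ (_ , l))    (inj₂ (_ , ¬l))    = contradiction l ¬l
  assigned-injective (inj₂ (_ , ¬l))   (inj₁ (_ , l))     = contradiction l ¬l
  assigned-injective (inj₂ (refl , _)) (inj₂ (refl , _))  = refl

  assigned-total : ∀ {L v} → IsSwing G L v → ∃ λ K → IsSplitting G K × Assigned G K L v
  assigned-total {L} {v} t@(s , _) with least? (dominates? G L) v
  ... | yes l = L , s , inj₁ (refl , l)
  ... | no ¬l = L ∪ ⁅ v ⁆ , insert-splitting t , inj₂ (refl , ¬l)

  -- A clique vertex without neighbours outside `K` can move to the stable side.
  ∖-splitting : ∀ {K x} → IsSplitting G K → (∀ u → u ∉ K → ¬ Adj G x u) → IsSplitting G (K ∖ x)
  ∖-splitting {K} {x} s nonadj = record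
    { clique = λ p q → clique s (p─q⊆p K ⁅ x ⁆ p) (p─q⊆p K ⁅ x ⁆ q)
    ; stable = st
    }
    where
    st : ∀ {u v} → u ∉ K ∖ x → v ∉ K ∖ x → ¬ Adj G u v
    st {u} {v} p q with u ≟ x | v ≟ x
    ... | yes refl | yes refl = adj-irrefl G
    ... | yes refl | no v≢x   = nonadj v (∉-∖⁻ q v≢x)
    ... | no u≢x   | yes refl = nonadj u (∉-∖⁻ p u≢x) ∘ adj-sym G
    ... | no u≢x   | no v≢x   = stable s (∉-∖⁻ p u≢x) (∉-∖⁻ q v≢x)

  ∖-dominates : ∀ {K x} → IsSplitting G K → x ∈ K → Dominates G (K ∖ x) x
  ∖-dominates {K} {x} s x∈K = ∉-∖ {L = K} , λ u p →
    clique s x∈K (p─q⊆p K ⁅ x ⁆ p) (λ { refl → ∉-∖ {L = K} p })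

  ∖⇒hasSwing : ∀ {K x} → IsSplitting G K → x ∈ K → (∀ u → u ∉ K → ¬ Adj G x u) →
    ¬ Least (Dominates G (K ∖ x)) x → HasSwing G K
  ∖⇒hasSwing s x∈K nonadj ¬l =
    _ , _ , (∖-splitting s nonadj , ∖-dominates s x∈K) , inj₂ (insert-∖ x∈K , ¬l)

  -- The smaller end `L` can only be `K` itself or `K ∖ x` with `x ∈ K`, so a search over vertices
  -- replaces one over subsets.
  hasSwing? : ∀ {K} → IsSplitting G K → Dec (HasSwing G K)
  hasSwing? {K} s with any? (dominates? G K)
  ... | yes (_ , d) = yes (dominates⇒hasSwing s d)
  ... | no ¬d with any? (λ x → (x ∈? K)
                  ×-dec all? (λ u → ¬? (u ∈? K) →-dec ¬? (adjacent G x u Bool.≟ true))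
                  ×-dec ¬? (least? (dominates? G (K ∖ x)) x))
  ...   | yes (_ , x∈K , nonadj , ¬l) = yes (∖⇒hasSwing s x∈K nonadj ¬l)
  ...   | no none = no λ
    { (_ , v , _ , inj₁ (refl , l)) → ¬d (v , proj₁ l)
    ; (L , v , (t , v∉L , _) , inj₂ (refl , ¬l)) → none (v , ∈-insert⁺ {L = L}
        , (λ u u∉K → stable t v∉L (u∉K ∘ x∈p∪q⁺ ∘ inj₁))
        -- Removing `v` from `L ∪ ⁅ v ⁆` gives back `L`, since `v ∉ L`.
        , subst (λ M → ¬ Least (Dominates G M) v)
            (insert-injective v∉L (∉-∖ {L = L ∪ ⁅ v ⁆}) (insert-∖ (∈-insert⁺ {L = L}))) ¬l)
    }

  -- Nothing dominates `L ∪ ⁅ v ⁆`, so an assigned swing would be of the second kind;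
  -- `insert-unique` identifies it with `(L , v)`, whose `v` is least.
  insert-least-canonical : ∀ {L v} → IsSplitting G L → Least (Dominates G L) v → ¬ HasSwing G (L ∪ ⁅ v ⁆)
  insert-least-canonical s l (M , w , t , inj₁ (refl , l′)) = insert-undominated (s , proj₁ l) (proj₁ l′)
  insert-least-canonical s l (M , w , t@(_ , w∉M , _) , inj₂ (e , ¬l))
    with refl ← insert-unique (s , proj₁ l) t ¬l e
    with refl ← insert-injective (proj₁ (proj₁ l)) w∉M e = ¬l l

  canonical-exists : ∀ {K} → IsSplitting G K → ∃ λ K′ → IsSplitting G K′ × ¬ HasSwing G K′
  canonical-exists {K} s with hasSwing? s
  ... | no ¬h = K , s , ¬h
  -- The root is reached from the smaller end of the assigned swing by inserting its least
  -- dominating vertex.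
  ... | yes (L , v , (t , d) , _) = let w , l = least-dominating d in
    L ∪ ⁅ w ⁆ , insert-splitting (t , proj₁ l) , insert-least-canonical t l

  -- Uniqueness of the canonical partition

  module _ {K K′ : Subset n} (s : IsSplitting G K) (s′ : IsSplitting G K′) where

    -- If `K′ ⊆ K`, then `x` dominates `K′` because `K` is a clique, and `K′` has a swing.
    canonical-⊈ : ¬ HasSwing G K′ → ∀ {x} → x ∈ K → x ∉ K′ → ¬ K′ ⊆ K
    canonical-⊈ ¬h x∈K x∉K′ K′⊆K = ¬h (dominates⇒hasSwing s′
      (x∉K′ , λ u u∈K′ → clique s x∈K (K′⊆K u∈K′) (λ { refl → x∉K′ u∈K′ })))

    module _ {x y} (x∈K : x ∈ K) (x∉K′ : x ∉ K′) (y∈K′ : y ∈ K′) (y∉K : y ∉ K) where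
      private
        -- Two vertices of `K` outside `K′` would be both adjacent and nonadjacent, so `x` is the
        -- only one.
        shared : ∀ {u} → u ∈ K → u ≢ x → u ∈ K′
        shared {u} u∈K u≢x with u ∈? K′
        ... | yes u∈K′ = u∈K′
        ... | no u∉K′  = contradiction (clique s u∈K x∈K u≢x) (stable s′ u∉K′ x∉K′)

        y-adj : ∀ {u} → u ∈ K → u ≢ x → Adj G y u
        y-adj u∈K u≢x = clique s′ y∈K′ (shared u∈K u≢x) (λ { refl → y∉K u∈K })

      -- Otherwise `y`, already adjacent to the rest of `K`, would dominate `K`.
      exchange-nonadjacent : ¬ HasSwing G K → ¬ Adj G x y
      exchange-nonadjacent ¬h xy = ¬h (dominates⇒hasSwing s (y∉K , dom))
        where
        dom : ∀ u → u ∈ K → Adj G y u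
        dom u u∈K with u ≟ x
        ... | yes refl = adj-sym G xy
        ... | no u≢x   = y-adj u∈K u≢x

      -- Since `x` has no neighbour outside `K`, `(K ∖ x , x)` is a swing. It is not assigned to
      -- `K`, so `x` is the least vertex dominating `K ∖ x`, and `y` is another such vertex.
      exchange-≤ : ¬ HasSwing G K → x ≤ᶠ y
      exchange-≤ ¬h with least? (dominates? G (K ∖ x)) x
      ... | no ¬l = contradiction (∖⇒hasSwing s x∈K nonadj ¬l) ¬h
        where
        nonadj : ∀ u → u ∉ K → ¬ Adj G x u
        nonadj u u∉K with u ≟ y | u ∈? K′
        ... | yes refl | _        = exchange-nonadjacent ¬h
        ... | no _     | no u∉K′  = stable s′ x∉K′ u∉K′
        ... | no u≢y   | yes u∈K′ = contradiction (clique s′ u∈K′ y∈K′ u≢y) (stable s u∉K y∉K)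
      ... | yes (_ , x≤) = x≤ y (y∉K ∘ p─q⊆p K ⁅ x ⁆ ,
        λ u p → y-adj (p─q⊆p K ⁅ x ⁆ p) (λ { refl → ∉-∖ {L = K} p }))

  -- If `x` lies in `K` only, some `y` lies in `K′` only by `canonical-⊈`. Exchanging the roles of
  -- the two partitions gives `x ≤ y` and `y ≤ x`, hence `x ≡ y`, which is absurd.
  canonical-⊆ : ∀ {K K′} → IsSplitting G K → IsSplitting G K′ → ¬ HasSwing G K → ¬ HasSwing G K′ → K ⊆ K′
  canonical-⊆ {K} {K′} s s′ ¬h ¬h′ {x} x∈K with x ∈? K′
  ... | yes x∈K′ = x∈K′
  ... | no x∉K′  = ⊥-elim (canonical-⊈ s s′ ¬h′ x∈K x∉K′ K′⊆K)
    where
    K′⊆K : K′ ⊆ K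
    K′⊆K {y} y∈K′ with y ∈? K
    ... | yes y∈K = y∈K
    ... | no y∉K  = contradiction
      (subst (_∈ K) (≤ᶠ-antisym (exchange-≤ s s′ x∈K x∉K′ y∈K′ y∉K ¬h) (exchange-≤ s′ s y∈K′ y∉K x∈K x∉K′ ¬h′)) x∈K)
      y∉K

-- The matching and the final count

assigned↔swing : ∀ n → Inverse
  (restrict (partitionedSetoid n) λ ((G , K) , _) → HasSwing G K) (swingSetoid n)
assigned↔swing n = inverseFromRelation
  (λ (((G , K) , _) , _) (((H , L) , v) , _) → G ≈ᴳ H × Assigned G K L v)
  (λ (((G , K) , _) , (L , v , s , a)) → (((G , L) , v) , s) , (λ _ _ → refl) , a)
  (λ (((H , L) , v) , s) → let K , t , a = assigned-total H s in
    (((H , K) , t) , (L , v , s , a)) , (λ _ _ → refl) , a)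
  (λ { {((G , _) , _) , _} {((G′ , _) , _) , _} {((H , _) , _) , s} {((H′ , _) , _) , s′} (e , a) (e′ , a′) (G≈G′ , refl) →
      -- Both swings are carried over to the one graph `G`, where `assigned-functional` compares
      -- them.
      let G′≈G = ≈ᴳ-sym {G = G} {G′} G≈G′
          L≡L′ , v≡v′ = assigned-functional G
            (swing-resp (≈ᴳ-sym {G = G} {H} e) s)
            (swing-resp (≈ᴳ-trans {G = H′} {G′} {G} (≈ᴳ-sym {G = G′} {H′} e′) G′≈G) s′)
            a (assigned-resp {G = G′} {G} G′≈G a′)
      in (≈ᴳ-trans {G = H} {G} {H′} (≈ᴳ-sym {G = G} {H} e) (≈ᴳ-trans {G = G} {G′} {H′} G≈G′ e′) , L≡L′) , v≡v′ })
  (λ { {((G , _) , _) , _} {((G′ , _) , _) , _} {((H , _) , _) , _} {((H′ , _) , _) , _} (e , a) (e′ , a′) ((H≈H′ , refl) , refl) →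
      let G≈G′ = ≈ᴳ-trans {G = G} {H} {G′} e (≈ᴳ-trans {G = H} {H′} {G′} H≈H′ (≈ᴳ-sym {G = G′} {H′} e′))
      in G≈G′ , assigned-injective G a (assigned-resp {G = G′} {G} (≈ᴳ-sym {G = G} {G′} G≈G′) a′) })

isSplit⇒splitting : ∀ {G : Graph n} → IsSplit G → ∃ (IsSplitting G)
isSplit⇒splitting {G = G} (K , S , K∪S≡⊤ , _ , cl , st) = K , record
  { clique = cl ; stable = λ u∉K v∉K → st (∈S u∉K) (∈S v∉K) }
  where
  ∈S : ∀ {u} → u ∉ K → u ∈ S
  ∈S {u} u∉K = [ (λ u∈K → contradiction u∈K u∉K) , id ]′ (x∈p∪q⁻ K S (subst (u ∈_) (sym K∪S≡⊤) ∈⊤))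

splitting⇒isSplit : ∀ {G : Graph n} {K} → IsSplitting G K → IsSplit G
splitting⇒isSplit {K = K} s = K , ∁ K , p∪∁p≡⊤ K ,
  (λ (_ , p) → let q , r = x∈p∩q⁻ K (∁ K) p in x∈p⇒x∉∁p q r) ,
  clique s , λ p q → stable s (x∈∁p⇒x∉p p) (x∈∁p⇒x∉p q)

-- Every split graph has exactly one canonical partition, so counting these counts each graph once.
split↔canonical : ∀ n → Inverse (splitGraphSetoid n)
  (restrict (partitionedSetoid n) λ ((G , K) , _) → ¬ HasSwing G K)
split↔canonical n = inverseFromRelation
  (λ (G , _) (((H , _) , _) , _) → G ≈ᴳ H)
  (λ (G , split) → let _ , s = isSplit⇒splitting split ; K , t , ¬h = canonical-exists G s in
    (((G , K) , t) , ¬h) , λ _ _ → refl)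
  (λ (((G , _) , s) , _) → (G , splitting⇒isSplit s) , λ _ _ → refl)
  (λ { {G , _} {G′ , _} {((H , _) , s) , ¬h} {((H′ , _) , s′) , ¬h′} e e′ G≈G′ →
      let H≈H′ = ≈ᴳ-trans {G = H} {G} {H′} (≈ᴳ-sym {G = G} {H} e) (≈ᴳ-trans {G = G} {G′} {H′} G≈G′ e′)
          H′≈H = ≈ᴳ-sym {G = H} {H′} H≈H′
          t    = splitting-resp H′≈H s′
          ¬h″  = ¬h′ ∘ hasSwing-resp {G = H} {H′} H≈H′
      in H≈H′ , ⊆-antisym (canonical-⊆ H s t ¬h ¬h″) (canonical-⊆ H t s ¬h″ ¬h) })
  (λ { {G , _} {G′ , _} {((H , _) , _) , _} {((H′ , _) , _) , _} e e′ (H≈H′ , _) →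
      ≈ᴳ-trans {G = G} {H} {G′} e (≈ᴳ-trans {G = H} {H′} {G′} H≈H′ (≈ᴳ-sym {G = G′} {H′} e′)) })

-- The exponents `n ∸ 1 ∸ k` and `n ∸ k ∸ 1` agree for positive `n`; for `n = 0` both sides are
-- multiplied by zero.
swing-count : ∀ n → n * partitionedCount (n ∸ 1) ≡
  n * (∑[ k < n ] (((n ∸ 1) C (toℕ k)) * 2 ^ (toℕ k * (n ∸ toℕ k ∸ 1))))
swing-count zero    = refl
swing-count (suc m) = cong (_*_ (suc m)) (sum-cong-≗ {suc m} λ k →
  cong (λ e → (m C toℕ k) * 2 ^ (toℕ k * e)) (exponent (toℕ k)))
  where
  exponent : ∀ k → m ∸ k ≡ suc m ∸ k ∸ 1
  exponent k = sym (trans (∸-+-assoc (suc m) k 1) (cong (_∸_ (suc m)) (+-comm k 1)))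

+-difference : ∀ {a c d} → c + d ≡ a → + c ≡ + a - + d
+-difference {c = c} {d} refl = sym (trans (m-n≡m⊖n (c + d) d)
  (trans (⊖-≥ (m≤n+m d c)) (cong (+_) (m+n∸n≡m c d))))

corollary3p4 : (n : ℕ) →
    ∃[ c ] (HasCardinality (splitGraphSetoid n) c ×
    + c ≡ (+ (∑[ k ≤ n ] ((n C (toℕ k)) * 2 ^ (toℕ k * (n ∸ toℕ k)))))
    - (+ (n * (∑[ k < n ] (((n ∸ 1) C (toℕ k)) * 2 ^ (toℕ k * (n ∸ toℕ k ∸ 1)))))))
corollary3p4 n =
  -- `c` counts the canonical partitions, one per split graph, and `d` the others, one per swing.
  let c , d , canonical≅c , assigned≅d , c+d≡a = cardinality-split {A = partitionedSetoid n}
        (λ ((G , _) , s) → hasSwing? G s)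
        (λ { {(G , _) , _} {(H , _) , _} (G≈H , refl) → hasSwing-resp {G = G} {H} G≈H })
        (partitioned-cardinality n)
      d≡ = trans (cardinality-unique assigned≅d (inv-trans (assigned↔swing n) (swing-cardinality n)))
                 (swing-count n)
  in c , inv-trans (split↔canonical n) canonical≅c , +-difference (trans (cong (_+_ c) (sym d≡)) c+d≡a)
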